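{- For every finite simple graph $G$ on $n$ vertices that has no isolated vertices and no isolated edges (i.e., no connected component isomorphic to $K_2$), $\gamma_{tg}(G) \leq \frac{3}{4}n$.
   Context: Let $G$ be a graph without isolated vertices. A vertex is totally dominated by a set $A\subseteq V(G)$ if it has a neighbor in $A$; a totally dominating set is a set totally dominating every vertex of $G$. In the total domination game on $G$, two players, Dominator and Staller, alternately select vertices of $G$, Dominator moving first. Each selected vertex must strictly increase the number of vertices totally dominated by the set of selected vertices. The game ends when the set of selected vertices is a totally dominating set of $G$. Dominator aims to minimize the number of selected vertices at the end, Staller aims to maximize it. The game total domination number $\gamma_{tg}(G)$ is the number of selected vertices at the end of the game when Dominator starts and both players play optimally. -}

module Defs where

open import Data.Nat using (ℕ; zero; suc)
open import Data.Bool using (Bool; true; false)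
open import Data.Fin using (Fin)
open import Data.Fin.Subset using (Subset; _∈_; _∉_; _∪_; ⁅_⁆; ⊥)
open import Data.Product using (Σ; ∃; _×_; _,_)
open import Data.Sum using (_⊎_)
open import Relation.Nullary using (¬_)
open import Relation.Binary.PropositionalEquality using (_≡_; _≢_)

record Graph (n : ℕ) : Set where
  field
    adj   : Fin n → Fin n → Bool
    sym   : ∀ u v → adj u v ≡ adj v u
    irrefl : ∀ v → adj v v ≡ false

module _ {n : ℕ} (G : Graph n) where
  open Graph G

  Adj : Fin n → Fin n → Set
  Adj u v = adj u v ≡ true

  NoIsolatedVertices : Set
  NoIsolatedVertices = ∀ v → ∃ λ u → Adj v u

  NoIsolatedEdges : Set
  NoIsolatedEdges = ∀ u v → Adj u v →
    (∃ λ w → w ≢ v × Adj u w) ⊎ (∃ λ w → w ≢ u × Adj v w)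

  TotDom : Subset n → Fin n → Set
  TotDom A w = ∃ λ u → u ∈ A × Adj u w

  IsTDS : Subset n → Set
  IsTDS A = ∀ w → TotDom A w

  -- Selecting v in position A is legal: it strictly increases the set of
  -- totally dominated vertices (some vertex becomes newly totally dominated;
  -- the dominated set is monotone under adding vertices).
  Legal : Subset n → Fin n → Set
  Legal A v = ∃ λ w → TotDom (A ∪ ⁅ v ⁆) w × ¬ TotDom A w

  data Player : Set where
    dominator staller : Player

  -- DomCan k p A : in the position where A has been selected and player p is
  -- to move, Dominator has a strategy guaranteeing that the game ends after
  -- at most k further moves, whatever Staller does.
  data DomCan : ℕ → Player → Subset n → Set where
    finished : ∀ {k p A} → IsTDS A → DomCan k p A
    domMove  : ∀ {k A} → ¬ IsTDS A → (v : Fin n) → Legal A v →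
               DomCan k staller (A ∪ ⁅ v ⁆) → DomCan (suc k) dominator A
    stalMove : ∀ {k A} → ¬ IsTDS A →
               (∀ v → Legal A v → DomCan k dominator (A ∪ ⁅ v ⁆)) →
               DomCan (suc k) staller A

  -- γ_tg(G) ≤ k : in the D-game (Dominator first, empty start) Dominator can
  -- force the game to end with at most k selected vertices.
  GameTotDomAtMost : ℕ → Set
  GameTotDomAtMost k = DomCan k dominator ⊥

{-# OPTIONS --safe #-}
module Submission where

-- Every vertex w is both a target (to be dominated) and a selector (to be played).  Each vertex
-- adjacent to leaves singles out one of them as special.  A target weighs 1 (2 if special), a selector
-- 2 (1 if special), so each vertex weighs 3.  The potential of a position adds the weights of the open
-- (undominated) targets and of the selectors that still dominate something new, except that an open
-- target none of whose selectors sees another open target counts exactly 4 together with its selectors.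
-- Dominator plays greedily and keeps the average decrease of the potential at 4 per move or more.
-- A Staller move gains at least 3, or at least 2 if it plays a special leaf.
--   * If some move gains 6, Dominator plays it, which pays for any Staller move.
--   * Otherwise the position is, and remains, Cool: after a Staller move gaining only 2 there is an
--     answer gaining 6.  So a move gaining 5 suffices.
--   * If no move gains 5 either, the position is, and remains, Cold: any Staller move gains 4, or gains 3
--     and has an answer gaining 6.  So a move gaining 4, which always exists, suffices.

open import Defs
open import Algebra.Properties.CommutativeMonoid.Sum as Sum using ()
open import Data.Bool using (true; false; if_then_else_)
import Data.Bool.Properties as Bool
open import Data.Fin using (Fin; zero; suc; _≟_)
open import Data.Fin.Properties using (any?; all?)
open import Data.Fin.Subset using (Subset; _∈_; _∪_; ⁅_⁆; ⊥)
open import Data.Fin.Subset.Properties using (_∈?_; x∈p∪q⁻; x∈p∪q⁺; x∈⁅x⁆; x∈⁅y⁆⇒x≡y)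
open import Data.List using (List; []; _∷_)
open import Data.List.Relation.Unary.All as All using (All; []; _∷_)
open import Data.Maybe using (Maybe; just; nothing)
open import Data.Maybe.Properties using (≡-dec; just-injective)
open import Data.Nat using (ℕ; zero; suc; _+_; _*_; _∸_; _≤_; _<_; z≤n; s≤s; _≤?_; _/_; _%_)
open import Data.Nat.DivMod using (m≡m%n+[m/n]*n; m%n<n)
open import Data.Nat.Properties using (≤-refl; ≤-trans; ≤-reflexive; ≤-pred; +-mono-≤; +-monoˡ-≤; +-monoʳ-≤; +-cancelˡ-≤; +-cancelʳ-≤; +-assoc; +-comm; +-identityʳ; *-comm; m≤m+n; m≤n+m; m+[n∸m]≡n; ∸-monoˡ-≤; +-0-commutativeMonoid; module ≤-Reasoning)
open import Data.Nat.Solver using (module +-*-Solver)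
open import Data.Product using (∃; _×_; _,_; proj₁)
open import Data.Sum using (_⊎_; inj₁; inj₂)
open import Function using (_∘_)
open import Relation.Binary.PropositionalEquality using (_≡_; _≢_; refl; sym; trans; cong; subst)
open import Relation.Nullary using (¬_; Dec; yes; no; does; contradiction)
open import Relation.Nullary.Decidable using (_×-dec_; _→-dec_; ¬?; decidable-stable; dec-true; dec-false)

open Sum +-0-commutativeMonoid using (sum; ∑-distrib-+)

-- Weighted counting over Fin n

sum-mono-≤ : ∀ {n} {f g : Fin n → ℕ} → (∀ i → f i ≤ g i) → sum f ≤ sum g
sum-mono-≤ {zero}  f≤g = z≤n
sum-mono-≤ {suc n} f≤g = +-mono-≤ (f≤g zero) (sum-mono-≤ (f≤g ∘ suc))

sum-const : ∀ n c → sum {n} (λ _ → c) ≡ n * c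
sum-const zero    c = refl
sum-const (suc n) c = cong (c +_) (sum-const n c)

zeroAt : ∀ {n} → Fin n → (Fin n → ℕ) → Fin n → ℕ
zeroAt i f j = if does (j ≟ i) then 0 else f j

sum-zeroAt : ∀ {n} (i : Fin n) (f : Fin n → ℕ) → sum f ≡ f i + sum (zeroAt i f)
sum-zeroAt zero    f = refl
sum-zeroAt (suc i) f = trans (cong (f zero +_) (sum-zeroAt i (f ∘ suc)))
  (solve 3 (λ a b c → a :+ (b :+ c) := b :+ (a :+ c)) refl (f zero) (f (suc i)) _)
  where open +-*-Solver

zeroAt-≢ : ∀ {n} {i j : Fin n} (f : Fin n → ℕ) → j ≢ i → zeroAt i f j ≡ f j
zeroAt-≢ {i = i} {j} f j≢i rewrite dec-false (j ≟ i) j≢i = refl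

≤-zeroAt : ∀ {n} {f g : Fin n → ℕ} {i} → (∀ j → f j ≤ g j) → f i ≡ 0 → ∀ j → f j ≤ zeroAt i g j
≤-zeroAt {i = i} f≤g fi≡0 j with j ≟ i
... | yes refl = ≤-reflexive fi≡0
... | no _     = f≤g j

-- A ledger of guaranteed losses: the listed indices are distinct, so each loss is counted once, and
-- the total keeps the shape `a + (b + 0)` that appears in the later bounds.
data Drop {n} (f g : Fin n → ℕ) : List (Fin n) → ℕ → Set where
  []  : Drop f g [] 0
  add : ∀ {i l a m} → All (_≢ i) l → f i ≡ 0 → a ≤ g i → Drop f g l m → Drop f g (i ∷ l) (a + m)

Drop-zeroAt : ∀ {n} {f g : Fin n → ℕ} {i l m} → All (_≢ i) l → Drop f g l m → Drop f (zeroAt i g) l m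
Drop-zeroAt []           []                   = []
Drop-zeroAt {g = g} (j≢i ∷ ≢i) (add ≢j f≡0 a≤g d) =
  add ≢j f≡0 (≤-trans a≤g (≤-reflexive (sym (zeroAt-≢ g j≢i)))) (Drop-zeroAt ≢i d)

sum-drop : ∀ {n} {f g : Fin n → ℕ} {l m} → (∀ i → f i ≤ g i) → Drop f g l m → m + sum f ≤ sum g
sum-drop f≤g []                                = sum-mono-≤ f≤g
sum-drop {f = f} {g} f≤g (add {i} {l} {a} {m} ≢i f≡0 a≤g d) = begin
  a + m + sum f          ≡⟨ +-assoc a m _ ⟩
  a + (m + sum f)        ≤⟨ +-mono-≤ a≤g (sum-drop (≤-zeroAt f≤g f≡0) (Drop-zeroAt ≢i d)) ⟩
  g i + sum (zeroAt i g) ≡⟨ sum-zeroAt i g ⟨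
  sum g                  ∎
  where open ≤-Reasoning

module _ {n : ℕ} where

  infixr 6 _·_
  _·_ : {P : Fin n → Set} → (∀ i → Dec (P i)) → (Fin n → ℕ) → Fin n → ℕ
  (P? · c) i = if does (P? i) then c i else 0

  ·-yes : ∀ {P : Fin n → Set} (P? : ∀ i → Dec (P i)) c {i} → P i → (P? · c) i ≡ c i
  ·-yes P? c {i} p rewrite dec-true (P? i) p = refl

  ·-no : ∀ {P : Fin n → Set} (P? : ∀ i → Dec (P i)) c {i} → ¬ P i → (P? · c) i ≡ 0
  ·-no P? c {i} ¬p rewrite dec-false (P? i) ¬p = refl

  ·-mono : ∀ {P Q : Fin n → Set} (P? : ∀ i → Dec (P i)) (Q? : ∀ i → Dec (Q i)) c →
           (∀ i → P i → Q i) → ∀ i → (P? · c) i ≤ (Q? · c) i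
  ·-mono P? Q? c P⊆Q i with P? i
  ... | no _  = z≤n
  ... | yes p = ≤-reflexive (sym (·-yes Q? c (P⊆Q i p)))

  ·-≤ : ∀ {P : Fin n → Set} (P? : ∀ i → Dec (P i)) c i → (P? · c) i ≤ c i
  ·-≤ P? c i with P? i
  ... | yes _ = ≤-refl
  ... | no _  = z≤n

  add· : ∀ {P Q : Fin n → Set} {P? : ∀ i → Dec (P i)} {Q? : ∀ i → Dec (Q i)} {c i l a m} →
         All (_≢ i) l → ¬ P i → Q i → a ≤ c i → Drop (P? · c) (Q? · c) l m →
         Drop (P? · c) (Q? · c) (i ∷ l) (a + m)
  add· {P? = P?} {Q?} {c} ≢i ¬p q a≤c =
    add ≢i (·-no P? c ¬p) (≤-trans a≤c (≤-reflexive (sym (·-yes Q? c q))))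

-- Leaves and special leaves

module Game {n : ℕ} (G : Graph n) (noIsolated : NoIsolatedVertices G) (noIsolatedEdge : NoIsolatedEdges G) where
  open Graph G using (adj) renaming (sym to adj-sym)

  infix 4 _~_ _~?_
  _~_ : Fin n → Fin n → Set
  _~_ = Adj G

  _~?_ : ∀ u v → Dec (u ~ v)
  u ~? v = adj u v Bool.≟ true

  ~-sym : ∀ {u v} → u ~ v → v ~ u
  ~-sym {u} {v} p = trans (adj-sym v u) p

  Leaf : Fin n → Set
  Leaf u = ∃ λ b → u ~ b × (∀ x → u ~ x → x ≡ b)

  leaf? : ∀ u → Dec (Leaf u)
  leaf? u = any? λ b → (u ~? b) ×-dec all? λ x → (u ~? x) →-dec (x ≟ b)

  leafAt? : ∀ b → Dec (∃ λ u → b ~ u × Leaf u)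
  leafAt? b = any? λ u → (b ~? u) ×-dec leaf? u

  chosenLeaf : Fin n → Maybe (Fin n)
  chosenLeaf b with leafAt? b
  ... | yes (u , _) = just u
  ... | no _        = nothing

  chosenLeaf-sound : ∀ {b u} → chosenLeaf b ≡ just u → b ~ u × Leaf u
  chosenLeaf-sound {b} eq with leafAt? b
  chosenLeaf-sound refl | yes (u , p) = p

  chosenLeaf-complete : ∀ {b u} → b ~ u → Leaf u → ∃ λ u′ → chosenLeaf b ≡ just u′
  chosenLeaf-complete {b} {u} b~u leaf with leafAt? b
  ... | yes (u′ , _) = u′ , refl
  ... | no ¬p        = contradiction (u , b~u , leaf) ¬p

  Special : Fin n → Set
  Special u = ∃ λ b → chosenLeaf b ≡ just u

  special? : ∀ u → Dec (Special u)
  special? u = any? λ b → ≡-dec _≟_ (chosenLeaf b) (just u)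

  special-neighbour : ∀ {u x y} → Special u → u ~ x → u ~ y → x ≡ y
  special-neighbour (b , eq) u~x u~y with chosenLeaf-sound eq
  ... | _ , _ , _ , only = trans (only _ u~x) (sym (only _ u~y))

  -- A special leaf is the leaf chosen by its only neighbour, so both vertices are `chosenLeaf w`.
  special-unique : ∀ {u v w} → Special u → Special v → w ~ u → w ~ v → u ≡ v
  special-unique su@(b , eq) sv@(b′ , eq′) w~u w~v
    with special-neighbour su (~-sym (proj₁ (chosenLeaf-sound eq))) (~-sym w~u)
       | special-neighbour sv (~-sym (proj₁ (chosenLeaf-sound eq′))) (~-sym w~v)
  ... | refl | refl = just-injective (trans (sym eq) eq′)

  leaf⇒special-sibling : ∀ {w x} → Leaf w → x ~ w → ∃ λ u → Special u × x ~ u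
  leaf⇒special-sibling leaf x~w with chosenLeaf-complete x~w leaf
  ... | u , eq = u , (_ , eq) , proj₁ (chosenLeaf-sound eq)

  two-neighbours⇒¬special : ∀ {x w y} → x ~ w → x ~ y → w ≢ y → ¬ Special x
  two-neighbours⇒¬special x~w x~y w≢y sx = w≢y (special-neighbour sx x~w x~y)

  -- Two adjacent special leaves would form a component `K₂`; this is where isolated edges are
  -- excluded.
  special-neighbour-¬special : ∀ {u b} → Special u → u ~ b → ¬ Special b
  special-neighbour-¬special su u~b sb with noIsolatedEdge _ _ u~b
  ... | inj₁ (w , w≢b , u~w) = w≢b (special-neighbour su u~w u~b)
  ... | inj₂ (w , w≢u , b~w) = w≢u (special-neighbour sb b~w (~-sym u~b))

  ¬leaf⇒other-neighbour : ∀ {w x} → ¬ Leaf w → w ~ x → ∃ λ x′ → x′ ≢ x × w ~ x′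
  ¬leaf⇒other-neighbour {w} {x} ¬leaf w~x with any? (λ x′ → ¬? (x′ ≟ x) ×-dec (w ~? x′))
  ... | yes p = p
  ... | no ¬p = contradiction
    (x , w~x , λ x′ w~x′ → decidable-stable (x′ ≟ x) λ x′≢x → ¬p (x′ , x′≢x , w~x′)) ¬leaf

  -- Weights of targets and selectors

  abstract
    τ σ : Fin n → ℕ
    τ u = if does (special? u) then 2 else 1
    σ u = if does (special? u) then 1 else 2

    τ+σ≡3 : ∀ u → τ u + σ u ≡ 3
    τ+σ≡3 u with does (special? u)
    ... | true  = refl
    ... | false = refl

    1≤τ : ∀ u → 1 ≤ τ u
    1≤τ u with does (special? u)
    ... | true  = s≤s z≤n
    ... | false = s≤s z≤n

    1≤σ : ∀ u → 1 ≤ σ u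
    1≤σ u with does (special? u)
    ... | true  = s≤s z≤n
    ... | false = s≤s z≤n

    2≤τ : ∀ {u} → Special u → 2 ≤ τ u
    2≤τ {u} su rewrite dec-true (special? u) su = ≤-refl

    2≤σ : ∀ {u} → ¬ Special u → 2 ≤ σ u
    2≤σ {u} ¬su rewrite dec-false (special? u) ¬su = ≤-refl

  σ[_] : Fin n → ℕ
  σ[ w ] = sum ((w ~?_) · σ)

  -- The weight of a target together with all its selectors, and its excess over 4. The potential
  -- uses the excess only for `Single` targets, where `4≤weight` makes the subtraction exact.
  weight surplus : Fin n → ℕ
  weight w = τ w + σ[ w ]
  surplus w = weight w ∸ 4

  σ[]-one : ∀ {w x a} → w ~ x → a ≤ σ x → a ≤ σ[ w ]
  σ[]-one {w} {x} {a} w~x a≤ = begin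
    a                    ≤⟨ a≤ ⟩
    σ x                  ≡⟨ ·-yes (w ~?_) σ w~x ⟨
    ((w ~?_) · σ) x      ≤⟨ m≤m+n _ _ ⟩
    _                    ≡⟨ sum-zeroAt x ((w ~?_) · σ) ⟨
    σ[ w ]               ∎
    where open ≤-Reasoning

  σ[]-two : ∀ {w x y a b} → x ≢ y → w ~ x → w ~ y → a ≤ σ x → b ≤ σ y → a + (b + 0) ≤ σ[ w ]
  σ[]-two {w} x≢y w~x w~y a≤ b≤ = ≤-trans (m≤m+n _ (sum {n} (λ _ → 0)))
    (sum-drop (λ _ → z≤n)
      (add ((x≢y ∘ sym) ∷ []) refl (≤-trans a≤ (≤-reflexive (sym (·-yes (w ~?_) σ w~x))))
        (add [] refl (≤-trans b≤ (≤-reflexive (sym (·-yes (w ~?_) σ w~y)))) [])))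

  -- Two neighbours, neither special, weigh 2 each, and the target adds at least 1.
  1≤surplus : ∀ {w x} → ¬ Leaf w → w ~ x → (∀ {v} → Special v → ¬ w ~ v) → 1 ≤ surplus w
  1≤surplus {w} {x} ¬leaf w~x ¬sp with ¬leaf⇒other-neighbour ¬leaf w~x
  ... | x′ , x′≢x , w~x′ = ∸-monoˡ-≤ 4 (+-mono-≤ (1≤τ w)
    (σ[]-two x′≢x w~x′ w~x (2≤σ λ s → ¬sp s w~x′) (2≤σ λ s → ¬sp s w~x)))

  -- Positions of the game

  Open : Subset n → Fin n → Set
  Open A w = ¬ TotDom G A w

  abstract
    open? : ∀ A w → Dec (Open A w)
    open? A w = ¬? (any? λ u → (u ∈? A) ×-dec (u ~? w))

  Live : Subset n → Fin n → Set
  Live A x = ∃ λ w → x ~ w × Open A w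

  abstract
    live? : ∀ A x → Dec (Live A x)
    live? A x = any? λ w → (x ~? w) ×-dec open? A w

  -- Two such targets never share a selector, so the blocks that count exactly 4 are disjoint.
  Single : Subset n → Fin n → Set
  Single A w = Open A w × (∀ x → w ~ x → ∀ y → x ~ y → Open A y → y ≡ w)

  abstract
    single? : ∀ A w → Dec (Single A w)
    single? A w = open? A w ×-dec
      all? λ x → (w ~? x) →-dec all? λ y → (x ~? y) →-dec (open? A y →-dec (y ≟ w))

  ¬single⇒pair : ∀ {A w} → Open A w → ¬ Single A w →
                 ∃ λ x → w ~ x × ∃ λ y → x ~ y × Open A y × y ≢ w
  ¬single⇒pair {A} {w} o ¬s
    with any? (λ x → (w ~? x) ×-dec any? λ y → (x ~? y) ×-dec (open? A y ×-dec ¬? (y ≟ w)))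
  ... | yes p = p
  ... | no ¬p = contradiction
    (o , λ x w~x y x~y oy → decidable-stable (y ≟ w) λ y≢w → ¬p (x , w~x , y , x~y , oy , y≢w)) ¬s

  infixl 6 _▸_
  _▸_ : Subset n → Fin n → Subset n
  A ▸ v = A ∪ ⁅ v ⁆

  open-▸⁻ : ∀ {A v w} → Open (A ▸ v) w → Open A w
  open-▸⁻ o (u , u∈A , u~w) = o (u , x∈p∪q⁺ (inj₁ u∈A) , u~w)

  covered : ∀ {A v w} → v ~ w → ¬ Open (A ▸ v) w
  covered {v = v} v~w o = o (v , x∈p∪q⁺ (inj₂ (x∈⁅x⁆ v)) , v~w)

  open-▸⁺ : ∀ {A v w} → Open A w → ¬ v ~ w → Open (A ▸ v) w
  open-▸⁺ {A} {v} o v≁w (u , u∈ , u~w) with x∈p∪q⁻ A ⁅ v ⁆ u∈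
  ... | inj₁ u∈A = o (u , u∈A , u~w)
  ... | inj₂ u∈v = v≁w (subst (_~ _) (x∈⁅y⁆⇒x≡y v u∈v) u~w)

  legal⇒live : ∀ {A v} → Legal G A v → Live A v
  legal⇒live {A} {v} (w , dom , o) =
    w , decidable-stable (v ~? w) (λ v≁w → open-▸⁺ o v≁w dom) , o

  live⇒legal : ∀ {A v} → Live A v → Legal G A v
  live⇒legal {v = v} (w , v~w , o) = w , (v , x∈p∪q⁺ (inj₂ (x∈⁅x⁆ v)) , v~w) , o

  single-▸ : ∀ {A v w} → Single A w → ¬ v ~ w → Single (A ▸ v) w
  single-▸ (o , only) v≁w = open-▸⁺ o v≁w , λ x w~x y x~y oy → only x w~x y x~y (open-▸⁻ oy)

  -- Both `w` and `u` have `x` as their only neighbour, so they become dominated by the same move.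
  open-sibling : ∀ {A w u x} → Leaf w → Special u → x ~ w → x ~ u → Open A w → Open A u
  open-sibling {A} {w} {u} {x} (b , w~b , only) su x~w x~u o (z , z∈A , z~u) =
    o (x , subst (_∈ A) (special-neighbour su (~-sym z~u) (~-sym x~u)) z∈A , x~w)

  -- A special `w` weighs 2 and its neighbour, not being special, another 2. A leaf that is not
  -- special cannot be single, because its special sibling is open too. Any other `w` has two
  -- neighbours, at most one of them special, giving `1 + 1 + 2`.
  4≤weight : ∀ {A w} → Single A w → 4 ≤ weight w
  4≤weight {A} {w} (o , only) with special? w | noIsolated w
  ... | yes sw | x , w~x = +-mono-≤ (2≤τ sw) (σ[]-one w~x (2≤σ (special-neighbour-¬special sw w~x)))
  ... | no ¬sw | x , w~x with leaf? w
  ...   | yes leaf with leaf⇒special-sibling leaf (~-sym w~x)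
  ...     | u , su , x~u = contradiction
    (subst Special (only x w~x u x~u (open-sibling leaf su (~-sym w~x) x~u o)) su) ¬sw
  4≤weight {A} {w} (o , only) | no ¬sw | x , w~x | no ¬leaf
    with ¬leaf⇒other-neighbour ¬leaf w~x | special? x
  ... | x′ , x′≢x , w~x′ | no ¬sx  = +-mono-≤ (1≤τ w) (σ[]-two x′≢x w~x′ w~x (1≤σ x′) (2≤σ ¬sx))
  ... | x′ , x′≢x , w~x′ | yes sx = +-mono-≤ (1≤τ w)
    (σ[]-two x′≢x w~x′ w~x (2≤σ λ sx′ → x′≢x (special-unique sx′ sx w~x′ w~x)) (1≤σ x))

  -- The potential and the effect of a move on it

  opens lives bonus : Subset n → ℕ
  opens A = sum (open? A · τ)
  lives A = sum (live? A · σ)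
  bonus A = sum (single? A · surplus)

  -- The potential is opens + lives ∸ bonus; all inequalities about it are kept subtraction-free.
  Gain : Subset n → Fin n → ℕ → Set
  Gain A v g = g + (opens (A ▸ v) + lives (A ▸ v) + bonus A) ≤ opens A + lives A + bonus (A ▸ v)

  gain? : ∀ A v g → Dec (Gain A v g)
  gain? A v g = _ ≤? _

  weaken : ∀ {A v g h} → g ≤ h → Gain A v h → Gain A v g
  weaken g≤h = ≤-trans (+-monoˡ-≤ _ g≤h)

  TargetDrop SelectorDrop SingleRise : Subset n → Fin n → List (Fin n) → ℕ → Set
  TargetDrop   A v = Drop (open? (A ▸ v) · τ) (open? A · τ)
  SelectorDrop A v = Drop (live? (A ▸ v) · σ) (live? A · σ)
  SingleRise   A v = Drop (single? A · surplus) (single? (A ▸ v) · surplus)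

  live-▸⁻ : ∀ {A v x} → Live (A ▸ v) x → Live A x
  live-▸⁻ (w , x~w , o) = w , x~w , open-▸⁻ o

  -- As `v` sees no single target, every single target stays single and no bonus is lost; the three
  -- sums can then be estimated separately.
  gain : ∀ {A v lT lS lB a b c} → (∀ {w} → v ~ w → ¬ Single A w) →
         TargetDrop A v lT a → SelectorDrop A v lS b → SingleRise A v lB c → Gain A v (a + b + c)
  gain {A} {v} {a = a} {b} {c} ¬single dT dS dB = begin
    a + b + c + (opens (A ▸ v) + lives (A ▸ v) + bonus A)
      ≡⟨ solve 6 (λ a b c p q r → a :+ b :+ c :+ (p :+ q :+ r) := a :+ p :+ (b :+ q) :+ (c :+ r)) refl
           a b c (opens (A ▸ v)) (lives (A ▸ v)) (bonus A) ⟩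
    a + opens (A ▸ v) + (b + lives (A ▸ v)) + (c + bonus A)
      ≤⟨ +-mono-≤ (+-mono-≤
           (sum-drop (·-mono (open? (A ▸ v)) (open? A) τ λ _ → open-▸⁻) dT)
           (sum-drop (·-mono (live? (A ▸ v)) (live? A) σ λ _ → live-▸⁻) dS))
           (sum-drop (·-mono (single? A) (single? (A ▸ v)) surplus
             λ _ s → single-▸ s λ v~w → ¬single v~w s) dB) ⟩
    opens A + lives A + bonus (A ▸ v) ∎
    where
    open ≤-Reasoning
    open +-*-Solver

  drop-target : ∀ {A v w l a m} → v ~ w → Open A w → a ≤ τ w → All (_≢ w) l →
                TargetDrop A v l m → TargetDrop A v (w ∷ l) (a + m)
  drop-target {A} {v} v~w o a≤τ ≢w = add· {P? = open? (A ▸ v)} {open? A} ≢w (covered v~w) o a≤τ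

  drop-selector : ∀ {A v x l a m} → Live A x → ¬ Live (A ▸ v) x → a ≤ σ x → All (_≢ x) l →
                  SelectorDrop A v l m → SelectorDrop A v (x ∷ l) (a + m)
  drop-selector {A} {v} l ¬l a≤σ ≢x = add· {P? = live? (A ▸ v)} {live? A} ≢x ¬l l a≤σ

  dead : ∀ {A v} → ¬ Live (A ▸ v) v
  dead (w , v~w , o) = covered v~w o

  -- A single target next to `v` is the only open target of `v`, hence equal to `w`.
  ¬single-shared : ∀ {A v w} → v ~ w → Open A w → ¬ Single A w → ∀ {y} → v ~ y → ¬ Single A y
  ¬single-shared v~w o ¬s v~y s@(_ , only) with only _ (~-sym v~y) _ v~w o
  ... | refl = ¬s s

  ¬single-pair : ∀ {A x w y} → x ~ w → x ~ y → Open A y → y ≢ w → ¬ Single A w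
  ¬single-pair x~w x~y oy y≢w (_ , only) = y≢w (only _ (~-sym x~w) _ x~y oy)

  -- The move removes `w` and kills all its neighbours, which frees `weight w`; the only bonus lost
  -- is `surplus w`, and the difference is 4.
  gain-single : ∀ {A v w} → v ~ w → Single A w → Gain A v 4
  gain-single {A} {v} {w} v~w s@(o , only) = begin
    4 + (opens′ + lives′ + bonus A)
      ≤⟨ +-monoʳ-≤ 4 (+-monoʳ-≤ (opens′ + lives′) bonus-≤) ⟩
    4 + (opens′ + lives′ + (surplus w + bonus (A ▸ v)))
      ≡⟨ solve 4 (λ p q r t → con 4 :+ (p :+ q :+ (r :+ t)) := (con 4 :+ r) :+ (p :+ q) :+ t) refl
           opens′ lives′ (surplus w) (bonus (A ▸ v)) ⟩
    4 + surplus w + (opens′ + lives′) + bonus (A ▸ v)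
      ≡⟨ cong (λ z → z + (opens′ + lives′) + bonus (A ▸ v)) (m+[n∸m]≡n (4≤weight s)) ⟩
    τ w + σ[ w ] + (opens′ + lives′) + bonus (A ▸ v)
      ≡⟨ solve 5 (λ a b p q t → a :+ b :+ (p :+ q) :+ t := (a :+ con 0 :+ p) :+ (b :+ q) :+ t) refl
           (τ w) σ[ w ] opens′ lives′ (bonus (A ▸ v)) ⟩
    τ w + 0 + opens′ + (σ[ w ] + lives′) + bonus (A ▸ v)
      ≤⟨ +-monoˡ-≤ (bonus (A ▸ v)) (+-mono-≤
           (sum-drop (·-mono (open? (A ▸ v)) (open? A) τ λ _ → open-▸⁻)
             (drop-target v~w o ≤-refl [] []))
           lives-≤) ⟩
    opens A + lives A + bonus (A ▸ v) ∎
    where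
    open ≤-Reasoning
    open +-*-Solver
    opens′ = opens (A ▸ v)
    lives′ = lives (A ▸ v)

    lives-pointwise : ∀ x → ((w ~?_) · σ) x + (live? (A ▸ v) · σ) x ≤ (live? A · σ) x
    lives-pointwise x with w ~? x
    ... | no _    = ·-mono (live? (A ▸ v)) (live? A) σ (λ _ → live-▸⁻) x
    ... | yes w~x = ≤-reflexive (trans
      (cong (σ x +_) (·-no (live? (A ▸ v)) σ λ (y , x~y , oy) →
        covered v~w (subst (Open (A ▸ v)) (only x w~x y x~y (open-▸⁻ oy)) oy)))
      (trans (+-identityʳ (σ x)) (sym (·-yes (live? A) σ (w , ~-sym w~x , o)))))

    lives-≤ : σ[ w ] + lives′ ≤ lives A
    lives-≤ = ≤-trans (≤-reflexive (sym (∑-distrib-+ ((w ~?_) · σ) (live? (A ▸ v) · σ))))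
                      (sum-mono-≤ lives-pointwise)

    bonus-pointwise : ∀ y → zeroAt w (single? A · surplus) y ≤ (single? (A ▸ v) · surplus) y
    bonus-pointwise y with y ≟ w | single? A y
    ... | yes _  | _                = z≤n
    ... | no _   | no _             = z≤n
    -- `v` sees the open target `w`, so it cannot be a selector of another single target.
    ... | no y≢w | yes sy@(_ , onlyʸ) = ≤-reflexive (sym (·-yes (single? (A ▸ v)) surplus
      (single-▸ sy λ v~y → y≢w (sym (onlyʸ v (~-sym v~y) w v~w o)))))

    bonus-≤ : bonus A ≤ surplus w + bonus (A ▸ v)
    bonus-≤ = ≤-trans (≤-reflexive (sum-zeroAt w (single? A · surplus)))
      (+-mono-≤ (·-≤ (single? A) surplus w) (sum-mono-≤ bonus-pointwise))

  -- The move covers a target and uses up the selector `v`: at least 2 for a special leaf, 3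
  -- otherwise.
  gain-any : ∀ {A v w} → v ~ w → Open A w → ¬ Single A w → Gain A v (1 + σ v)
  gain-any {A} {v} {w} v~w o ¬s = weaken
    (≤-reflexive (solve 1 (λ a → con 1 :+ a := con 1 :+ con 0 :+ (a :+ con 0) :+ con 0) refl (σ v)))
    (gain (¬single-shared v~w o ¬s)
      (drop-target v~w o (1≤τ w) [] [])
      (drop-selector (w , v~w , o) dead ≤-refl [] []) [])
    where open +-*-Solver

  -- With two neighbours `x` is not special, so its own death yields 2; `l` lists further selectors
  -- that die.
  gain-pair : ∀ {A x w y a b l m} → x ~ w → x ~ y → Open A w → Open A y → w ≢ y →
              a ≤ τ w → b ≤ τ y → All (_≢ x) l → SelectorDrop A x l m →
              Gain A x (a + (b + 0) + (2 + m) + 0)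
  gain-pair {A} {x} {w} {y} x~w x~y ow oy w≢y a≤ b≤ ≢x d =
    gain (¬single-shared x~w ow (¬single-pair x~w x~y oy (w≢y ∘ sym)))
      (drop-target x~w ow a≤ ((w≢y ∘ sym) ∷ [])
        (drop-target x~y oy b≤ [] []))
      (drop-selector (w , x~w , ow) dead (2≤σ (two-neighbours⇒¬special x~w x~y w≢y)) ≢x d) []

  gain-triple : ∀ {A x w y z l m} → x ~ w → x ~ y → x ~ z → Open A w → Open A y → Open A z →
                w ≢ y → w ≢ z → y ≢ z → All (_≢ x) l → SelectorDrop A x l m → Gain A x (5 + m)
  gain-triple {A} {x} {w} {y} {z} {m = m} x~w x~y x~z ow oy oz w≢y w≢z y≢z ≢x d =
    weaken (≤-reflexive (cong (5 +_) (sym (+-identityʳ m))))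
    (gain (¬single-shared x~w ow (¬single-pair x~w x~y oy (w≢y ∘ sym)))
      (drop-target x~w ow (1≤τ w) ((w≢y ∘ sym) ∷ (w≢z ∘ sym) ∷ [])
        (drop-target x~y oy (1≤τ y) ((y≢z ∘ sym) ∷ [])
          (drop-target x~z oz (1≤τ z) [] [])))
      (drop-selector (w , x~w , ow) dead (2≤σ (two-neighbours⇒¬special x~w x~y w≢y)) ≢x d) [])

  special-dies : ∀ {A x v w} → Special v → v ~ w → x ~ w → ¬ Live (A ▸ x) v
  special-dies sv v~w x~w (y , v~y , oy) with special-neighbour sv v~w v~y
  ... | refl = covered x~w oy

  special≢ : ∀ {v w x y} → Special v → v ~ w → x ~ y → w ≢ y → v ≢ x
  special≢ sv v~w x~y w≢y refl = w≢y (special-neighbour sv v~w x~y)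

  drop-special : ∀ {A x v w l m} → Special v → v ~ w → x ~ w → Open A w →
                 All (_≢ v) l → SelectorDrop A x l m → SelectorDrop A x (v ∷ l) (1 + m)
  drop-special {v = v} sv v~w x~w o = drop-selector (_ , v~w , o) (special-dies sv v~w x~w) (1≤σ v)

  -- What is true when no move gains 6, respectively 5

  NoMove : ℕ → Subset n → Set
  NoMove g A = ∀ v → Live A v → ¬ Gain A v g

  -- Once `w` is covered, `y` is the last target `x` can serve. Every clause survives further moves,
  -- since open targets only disappear.
  record Tame (A : Subset n) {x w y : Fin n} (x~w : x ~ w) (x~y : x ~ y) : Set where
    field
      ¬special-target   : ¬ Special y
      ¬special-selector : ∀ {v} → Special v → ¬ y ~ v
      only              : ∀ {z} → x ~ z → Open A z → z ≢ w → z ≡ y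

  Cool : Subset n → Set
  Cool A = ∀ {v w x y} → Special v → v ~ w → Open A w → (x~w : x ~ w) (x~y : x ~ y) →
           Open A y → y ≢ w → Tame A x~w x~y

  record Cold (A : Subset n) : Set where
    field
      special-single : ∀ {v w} → Special v → v ~ w → Open A w → Single A w
      tame : ∀ {x w y} (x~w : x ~ w) (x~y : x ~ y) → Open A w → Open A y → y ≢ w → Tame A x~w x~y

  cool-▸ : ∀ {A v} → Cool A → Cool (A ▸ v)
  cool-▸ cool sv v~w o x~w x~y oy y≢w = record
    { ¬special-target = ¬special-target ; ¬special-selector = ¬special-selector
    ; only = λ x~z oz → only x~z (open-▸⁻ oz) }
    where open Tame (cool sv v~w (open-▸⁻ o) x~w x~y (open-▸⁻ oy) y≢w)

  cold⇒cool : ∀ {A} → Cold A → Cool A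
  cold⇒cool cold sv v~w o x~w x~y oy y≢w =
    contradiction (Cold.special-single cold sv v~w o) (¬single-pair x~w x~y oy y≢w)

  cold-▸ : ∀ {A v} → Cold A → Cold (A ▸ v)
  cold-▸ cold = record
    { special-single = λ sv v~w o → single-▸ (special-single sv v~w (open-▸⁻ o)) λ u~w → covered u~w o
    ; tame = λ x~w x~y ow oy y≢w → let open Tame (tame x~w x~y (open-▸⁻ ow) (open-▸⁻ oy) y≢w) in record
        { ¬special-target = ¬special-target ; ¬special-selector = ¬special-selector
        ; only = λ x~z oz → only x~z (open-▸⁻ oz) } }
    where open Cold cold

  -- Playing `x` gains 1 each for `w` and `y`, 2 for `x` and 1 for the dying leaf `v`. A violation
  -- of any clause of `Tame` adds 1 more and makes 6.
  no6⇒cool : ∀ {A} → NoMove 6 A → Cool A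
  no6⇒cool {A} no6 {v} {w} {x} {y} sv v~w ow x~w x~y oy y≢w = record
    { ¬special-target = λ sy → no6 x (w , x~w , ow)
        (gain-pair x~w x~y ow oy w≢y (1≤τ w) (2≤τ sy) (v≢x ∷ []) v-drop)
    ; ¬special-selector = λ {v′} sv′ y~v′ → no6 x (w , x~w , ow)
        (gain-pair x~w x~y ow oy w≢y (1≤τ w) (1≤τ y)
          (v≢x ∷ special≢ sv′ (~-sym y~v′) x~w y≢w ∷ [])
          (drop-special sv v~w x~w ow ((special≢ sv′ (~-sym y~v′) v~w y≢w) ∷ [])
            (drop-special sv′ (~-sym y~v′) x~y oy [] [])))
    ; only = λ {z} x~z oz z≢w → decidable-stable (z ≟ y) λ z≢y → no6 x (w , x~w , ow)
        (gain-triple x~w x~y x~z ow oy oz w≢y (z≢w ∘ sym) (z≢y ∘ sym) (v≢x ∷ []) v-drop)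
    }
    where
    w≢y = y≢w ∘ sym
    v≢x = special≢ sv v~w x~y w≢y
    v-drop = drop-special sv v~w x~w ow [] []

  -- A selector with two open targets already gains 4. A special leaf at one of them, a special
  -- target or a third open target would make 5.
  no5⇒cold : ∀ {A} → NoMove 5 A → Cold A
  no5⇒cold {A} no5 = record { special-single = special-single ; tame = tame }
    where
    special-pair : ∀ {v w x y} → Special v → v ~ w → Open A w → x ~ w → x ~ y → Open A y → ¬ y ≢ w
    special-pair {w = w} {x} {y} sv v~w ow x~w x~y oy y≢w = no5 x (w , x~w , ow)
      (gain-pair x~w x~y ow oy (y≢w ∘ sym) (1≤τ w) (1≤τ y)
        (special≢ sv v~w x~y (y≢w ∘ sym) ∷ []) (drop-special sv v~w x~w ow [] []))

    special-single : ∀ {v w} → Special v → v ~ w → Open A w → Single A w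
    special-single sv v~w ow = ow , λ x w~x y x~y oy →
      decidable-stable (y ≟ _) (special-pair sv v~w ow (~-sym w~x) x~y oy)

    tame : ∀ {x w y} (x~w : x ~ w) (x~y : x ~ y) → Open A w → Open A y → y ≢ w → Tame A x~w x~y
    tame {x} {w} {y} x~w x~y ow oy y≢w = record
      { ¬special-target = λ sy → no5 x (w , x~w , ow)
          (gain-pair x~w x~y ow oy (y≢w ∘ sym) (1≤τ w) (2≤τ sy) [] [])
      ; ¬special-selector = λ sv y~v → special-pair sv (~-sym y~v) oy x~y x~w ow (y≢w ∘ sym)
      ; only = λ {z} x~z oz z≢w → decidable-stable (z ≟ y) λ z≢y → no5 x (w , x~w , ow)
          (gain-triple x~w x~y x~z ow oy oz (y≢w ∘ sym) (z≢w ∘ sym) (z≢y ∘ sym) [] [])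
      }

  -- If `y` were a leaf, its special sibling at `x` would be open and different from `w`, hence
  -- equal to `y`, which is not special.
  tame⇒¬leaf : ∀ {A x w y} {x~w : x ~ w} {x~y : x ~ y} → Open A y → ¬ Special w →
               Tame A x~w x~y → ¬ Leaf y
  tame⇒¬leaf {x~y = x~y} oy ¬sw t leaf with leaf⇒special-sibling leaf x~y
  ... | u , su , x~u = ¬special-target (subst Special
    (only x~u (open-sibling leaf su x~y x~u oy) λ { refl → ¬sw su }) su)
    where open Tame t

  -- If y is left as the only target of its selectors, then its surplus is gained at once; otherwise
  -- some z dominates y and a further target, and x dies with y.
  reply : ∀ {A v w x y} → v ~ w → Open A w → (x~w : x ~ w) (x~y : x ~ y) → Open A y → y ≢ w →
          ¬ v ~ y → ¬ Special w → Tame A x~w x~y →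
          Gain A v (2 + σ v) ⊎ ∃ λ z → Live (A ▸ v) z × Gain (A ▸ v) z 6
  reply {A} {v} {w} {x} {y} v~w ow x~w x~y oy y≢w v≁y ¬sw t with single? (A ▸ v) y
  ... | yes s = inj₁ (weaken
    (≤-reflexive (solve 1 (λ a → con 2 :+ a := con 1 :+ con 0 :+ (a :+ con 0) :+ (con 1 :+ con 0)) refl (σ v)))
    (gain (¬single-shared v~w ow (¬single-pair x~w x~y oy y≢w))
      (drop-target v~w ow (1≤τ w) [] [])
      (drop-selector (w , v~w , ow) dead ≤-refl [] [])
      (add· {P? = single? A} {single? (A ▸ v)} [] (¬single-pair x~y x~w ow (y≢w ∘ sym)) s
        (1≤surplus (tame⇒¬leaf oy ¬sw t) (~-sym x~y) (Tame.¬special-selector t)) [])))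
    where open +-*-Solver
  ... | no ¬s with ¬single⇒pair (open-▸⁺ oy v≁y) ¬s
  ...   | z , y~z , y₂ , z~y₂ , oy₂ , y₂≢y = inj₂ (z , (y₂ , z~y₂ , oy₂) ,
    -- The 6 consists of 1 each for `y` and `y₂`, and 2 each for the selectors `z` and `x`.
    gain-pair (~-sym y~z) z~y₂ (open-▸⁺ oy v≁y) oy₂ (y₂≢y ∘ sym) (1≤τ y) (1≤τ y₂) (x≢z ∷ [])
      (drop-selector (y , x~y , open-▸⁺ oy v≁y) x-dies (2≤σ (two-neighbours⇒¬special x~y x~w y≢w)) [] []))
    where
    only-y : ∀ {u} → x ~ u → Open (A ▸ v) u → u ≡ y
    only-y x~u ou = Tame.only t x~u (open-▸⁻ ou) λ { refl → covered v~w ou }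
    x≢z : x ≢ z
    x≢z refl = y₂≢y (only-y z~y₂ oy₂)
    x-dies : ¬ Live (A ▸ v ▸ z) x
    x-dies (u , x~u , ou) with only-y x~u (open-▸⁻ ou)
    ... | refl = covered (~-sym y~z) ou

  -- The strategy

  -- c is four times the number of moves that may still be made, plus a remainder; the 3 in
  -- dominator-turn is harmless because an unfinished position has potential at least 4.
  Bounded : Subset n → ℕ → Set
  Bounded A c = opens A + lives A ≤ c + bonus A

  bounded-▸ : ∀ {A v} g {c} → Gain A v g → Bounded A (g + c) → Bounded (A ▸ v) c
  bounded-▸ {A} {v} g {c} gn bd = +-cancelʳ-≤ (bonus A) _ _ (+-cancelˡ-≤ g _ _ (begin
    g + (opens (A ▸ v) + lives (A ▸ v) + bonus A) ≤⟨ gn ⟩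
    opens A + lives A + bonus (A ▸ v)             ≤⟨ +-monoˡ-≤ _ bd ⟩
    g + c + bonus A + bonus (A ▸ v)
      ≡⟨ solve 4 (λ g c p q → g :+ c :+ p :+ q := g :+ (c :+ q :+ p)) refl g c (bonus A) (bonus (A ▸ v)) ⟩
    g + (c + bonus (A ▸ v) + bonus A)             ∎))
    where
    open ≤-Reasoning
    open +-*-Solver

  -- Either some open target is single, or a selector with two open targets gains `1 + 1 + 2`.
  good-move : ∀ {A w} → Open A w → ∃ λ v → Live A v × Gain A v 4
  good-move {A} {w} o with single? A w
  ... | yes s with noIsolated w
  ...   | v , w~v = v , (w , ~-sym w~v , o) , gain-single (~-sym w~v) s
  good-move {A} {w} o | no ¬s with ¬single⇒pair o ¬s
  ...   | x , w~x , y , x~y , oy , y≢w = x , (w , ~-sym w~x , o) ,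
    gain-pair (~-sym w~x) x~y o oy (y≢w ∘ sym) (1≤τ w) (1≤τ y) [] []

  opens-▸ : ∀ {A v} → Live A v → opens (A ▸ v) < opens A
  opens-▸ {A} {v} (w , v~w , o) = sum-drop (·-mono (open? (A ▸ v)) (open? A) τ λ _ → open-▸⁻)
    (drop-target v~w o (1≤τ w) [] [])

  -- The potential is nonnegative, and at least 4 while a target is open: a good move costs 4 and
  -- leaves a nonnegative potential. The induction is on the bound `m` for `opens A`.
  bonus≤ : ∀ m A → opens A ≤ m → bonus A ≤ opens A + lives A
  4+bonus≤ : ∀ m A {w} → opens A ≤ m → Open A w → 4 + bonus A ≤ opens A + lives A

  bonus≤ m A ≤m with any? (open? A)
  ... | yes (w , o) = ≤-trans (m≤n+m _ 4) (4+bonus≤ m A ≤m o)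
  ... | no ¬o       = ≤-trans (sum-mono-≤ λ i →
    ≤-trans (≤-reflexive (·-no (single? A) surplus λ s → ¬o (i , proj₁ s))) z≤n) (m≤m+n _ _)

  4+bonus≤ m A ≤m o with good-move o
  4+bonus≤ zero    A ≤m o | v , l , _  = contradiction (≤-trans (opens-▸ l) ≤m) λ ()
  4+bonus≤ (suc m) A ≤m o | v , l , gn = +-cancelʳ-≤ (bonus (A ▸ v)) _ _ (begin
    4 + bonus A + bonus (A ▸ v)
      ≤⟨ +-monoʳ-≤ (4 + bonus A) (bonus≤ m (A ▸ v) (≤-pred (≤-trans (opens-▸ l) ≤m))) ⟩
    4 + bonus A + (opens (A ▸ v) + lives (A ▸ v)) ≡⟨ cong (4 +_) (+-comm (bonus A) _) ⟩
    4 + (opens (A ▸ v) + lives (A ▸ v) + bonus A) ≤⟨ gn ⟩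
    opens A + lives A + bonus (A ▸ v) ∎)
    where open ≤-Reasoning

  4≤bound : ∀ {A w c} → Open A w → Bounded A c → 4 ≤ c
  4≤bound {A} o bd = +-cancelʳ-≤ (bonus A) _ _ (≤-trans (4+bonus≤ _ A ≤-refl o) bd)

  status : ∀ A → IsTDS G A ⊎ ∃ (Open A)
  status A with any? (open? A)
  ... | yes p = inj₂ p
  ... | no ¬p = inj₁ λ w → decidable-stable (any? λ u → (u ∈? A) ×-dec (u ~? w)) λ o → ¬p (w , o)

  move? : ∀ g A → (∃ λ v → Live A v × Gain A v g) ⊎ NoMove g A
  move? g A with any? (λ v → live? A v ×-dec gain? A v g)
  ... | yes p = inj₁ p
  ... | no ¬p = inj₂ λ v l gn → ¬p (v , l , gn)

  -- Each move is paid with 4. From remainder 3, a Dominator gain of 6, 5 or 4 leaves remainder 1, 2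
  -- or 3, and a Staller gain of 2, 3 or 4 respectively restores 3. A Staller move falling short by
  -- one leaves 4, and the answer gaining 6 leads back to `staller-cool`.
  dominator-turn : ∀ k A → Bounded A (3 + k * 4) → DomCan G k dominator A
  staller-cold : ∀ k A → Cold A → Bounded A (3 + k * 4) → DomCan G k staller A
  staller-cool : ∀ k A → Cool A → Bounded A (2 + k * 4) → DomCan G k staller A
  staller-turn : ∀ k A → Bounded A (1 + k * 4) → DomCan G k staller A
  dominator-reply : ∀ k {A v} → Live A v → Gain A v 6 → Cool A → Bounded A (4 + k * 4) → DomCan G k dominator A

  -- A move gaining 6 needs a potential of at least 6, as the potential after it is nonnegative.
  dominator-reply zero {A} {v} l gn cool bd = contradiction (+-cancelʳ-≤ _ 6 4 (begin
    6 + (opens (A ▸ v) + lives (A ▸ v) + bonus A) ≤⟨ gn ⟩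
    opens A + lives A + bonus (A ▸ v)             ≤⟨ +-mono-≤ bd (bonus≤ _ (A ▸ v) ≤-refl) ⟩
    4 + bonus A + (opens (A ▸ v) + lives (A ▸ v)) ≡⟨ cong (4 +_) (+-comm (bonus A) _) ⟩
    4 + (opens (A ▸ v) + lives (A ▸ v) + bonus A) ∎)) λ { (s≤s (s≤s (s≤s (s≤s ())))) }
    where open ≤-Reasoning
  dominator-reply (suc k) {A} {v} l@(w , _ , o) gn cool bd =
    domMove (λ tds → o (tds w)) v (live⇒legal l)
      (staller-cool k (A ▸ v) (cool-▸ cool) (bounded-▸ 6 gn bd))

  dominator-turn k A bd with status A
  dominator-turn k A bd | inj₁ tds = finished tds
  dominator-turn zero A bd | inj₂ (w , o) = contradiction (4≤bound o bd) λ { (s≤s (s≤s (s≤s ()))) }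
  dominator-turn (suc k) A bd | inj₂ (w , o) with move? 6 A
  ... | inj₁ (v , l , gn) = domMove (λ tds → o (tds w)) v (live⇒legal l)
    (staller-turn k (A ▸ v) (bounded-▸ 6 gn bd))
  ... | inj₂ no6 with move? 5 A
  ...   | inj₁ (v , l , gn) = domMove (λ tds → o (tds w)) v (live⇒legal l)
    (staller-cool k (A ▸ v) (cool-▸ (no6⇒cool no6)) (bounded-▸ 5 gn bd))
  ...   | inj₂ no5 with good-move o
  ...     | v , l , gn = domMove (λ tds → o (tds w)) v (live⇒legal l)
    (staller-cold k (A ▸ v) (cold-▸ (no5⇒cold no5)) (bounded-▸ 4 gn bd))

  staller-cold k A cold bd with status A
  staller-cold k A cold bd | inj₁ tds = finished tds
  staller-cold zero A cold bd | inj₂ (w , o) = contradiction (4≤bound o bd) λ { (s≤s (s≤s (s≤s ()))) }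
  staller-cold (suc k) A cold bd | inj₂ (w₀ , o₀) =
    stalMove (λ tds → o₀ (tds w₀)) λ v lg → answer v (legal⇒live lg)
    where
    open Cold cold
    answer : ∀ v → Live A v → DomCan G k dominator (A ▸ v)
    answer v (w , v~w , o) with single? A w
    ... | yes s = dominator-turn k (A ▸ v) (bounded-▸ 4 (gain-single v~w s) bd)
    ... | no ¬s with ¬single⇒pair o ¬s
    ...   | x , w~x , y , x~y , oy , y≢w with v ~? y
    ...     | yes v~y = dominator-turn k (A ▸ v) (bounded-▸ 4
      (gain-pair v~w v~y o oy (y≢w ∘ sym) (1≤τ w) (1≤τ y) [] []) bd)
    -- That `w` is not special is tameness with the roles of `w` and `y` exchanged.
    ...     | no v≁y with reply v~w o (~-sym w~x) x~y oy y≢w v≁y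
                            (Tame.¬special-target (tame x~y (~-sym w~x) oy o (y≢w ∘ sym)))
                            (tame (~-sym w~x) x~y o oy y≢w)
    -- A special `v` would make `w` single, so `v` weighs 2 here and below.
    ...       | inj₁ gn = dominator-turn k (A ▸ v) (bounded-▸ 4
      (weaken (+-monoʳ-≤ 2 (2≤σ λ sv → ¬s (special-single sv v~w o))) gn) bd)
    ...       | inj₂ (z , l , gn) = dominator-reply k l gn (cool-▸ (cold⇒cool cold)) (bounded-▸ 3
      (weaken (+-monoʳ-≤ 1 (2≤σ λ sv → ¬s (special-single sv v~w o))) (gain-any v~w o ¬s)) bd)

  staller-cool k A cool bd with status A
  staller-cool k A cool bd | inj₁ tds = finished tds
  staller-cool zero A cool bd | inj₂ (w , o) = contradiction (4≤bound o bd) λ { (s≤s (s≤s ())) }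
  staller-cool (suc k) A cool bd | inj₂ (w₀ , o₀) =
    stalMove (λ tds → o₀ (tds w₀)) λ v lg → answer v (legal⇒live lg)
    where
    answer : ∀ v → Live A v → DomCan G k dominator (A ▸ v)
    answer v (w , v~w , o) with single? A w
    ... | yes s = dominator-turn k (A ▸ v) (bounded-▸ 3 (weaken (m≤n+m 3 1) (gain-single v~w s)) bd)
    ... | no ¬s with special? v
    ...   | no ¬sv = dominator-turn k (A ▸ v) (bounded-▸ 3 (weaken (+-monoʳ-≤ 1 (2≤σ ¬sv)) (gain-any v~w o ¬s)) bd)
    -- Only here can the gain be as low as 2; `reply` finds the missing unit or an answer gaining 6.
    ...   | yes sv with ¬single⇒pair o ¬s
    ...     | x , w~x , y , x~y , oy , y≢w
      with reply v~w o (~-sym w~x) x~y oy y≢w (λ v~y → y≢w (special-neighbour sv v~y v~w))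
             (special-neighbour-¬special sv v~w) (cool sv v~w o (~-sym w~x) x~y oy y≢w)
    ...       | inj₁ gn = dominator-turn k (A ▸ v) (bounded-▸ 3 (weaken (+-monoʳ-≤ 2 (1≤σ v)) gn) bd)
    ...       | inj₂ (z , l , gn) = dominator-reply k l gn (cool-▸ cool)
      (bounded-▸ 2 (weaken (+-monoʳ-≤ 1 (1≤σ v)) (gain-any v~w o ¬s)) bd)

  staller-turn k A bd with status A
  staller-turn k A bd | inj₁ tds = finished tds
  staller-turn zero A bd | inj₂ (w , o) = contradiction (4≤bound o bd) λ { (s≤s ()) }
  staller-turn (suc k) A bd | inj₂ (w₀ , o₀) =
    stalMove (λ tds → o₀ (tds w₀)) λ v lg → answer v (legal⇒live lg)
    where
    answer : ∀ v → Live A v → DomCan G k dominator (A ▸ v)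
    answer v (w , v~w , o) with single? A w
    ... | yes s = dominator-turn k (A ▸ v) (bounded-▸ 2 (weaken (m≤n+m 2 2) (gain-single v~w s)) bd)
    ... | no ¬s = dominator-turn k (A ▸ v) (bounded-▸ 2 (weaken (+-monoʳ-≤ 1 (1≤σ v)) (gain-any v~w o ¬s)) bd)

  -- The initial potential and the final bound

  opens+lives≤3n : ∀ A → opens A + lives A ≤ n * 3
  opens+lives≤3n A = begin
    opens A + lives A              ≡⟨ ∑-distrib-+ (open? A · τ) (live? A · σ) ⟨
    sum (λ i → (open? A · τ) i + (live? A · σ) i)
      ≤⟨ sum-mono-≤ (λ i → ≤-trans (+-mono-≤ (·-≤ (open? A) τ i) (·-≤ (live? A) σ i)) (≤-reflexive (τ+σ≡3 i))) ⟩
    sum {n} (λ _ → 3)              ≡⟨ sum-const n 3 ⟩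
    n * 3                          ∎
    where open ≤-Reasoning

theorem1p2 : ∀ (n : ℕ) (G : Graph n) → NoIsolatedVertices G → NoIsolatedEdges G →
    ∃ λ k → 4 * k ≤ 3 * n × GameTotDomAtMost G k
theorem1p2 n G iv ie = k , upper , dominator-turn k ⊥ (≤-trans (opens+lives≤3n ⊥) (≤-trans lower (m≤m+n _ _)))
  where
  open Game G iv ie
  -- The remainder modulo 4 is at most 3, which is the slack allowed by `dominator-turn`.
  k = 3 * n / 4
  division : 3 * n ≡ 3 * n % 4 + k * 4
  division = m≡m%n+[m/n]*n (3 * n) 4
  upper : 4 * k ≤ 3 * n
  upper = ≤-trans (≤-reflexive (*-comm 4 k)) (≤-trans (m≤n+m _ _) (≤-reflexive (sym division)))
  lower : n * 3 ≤ 3 + k * 4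
  lower = ≤-trans (≤-reflexive (trans (*-comm n 3) division)) (+-monoˡ-≤ (k * 4) (≤-pred (m%n<n (3 * n) 4)))
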